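{- Let $A$ be a finite set with $|A|>1$. The conservative revital $Cons(A)$ is not finitely generated. In fact, if $C\subseteq Cons(A)$ is a finitely generated revital, then there exists $f\in Cons(A)$ such that $f\oplus\mathrm{id}_k\notin C$ for all $k=0,1,2,\dots$ (where $f\oplus\mathrm{id}_0=f$).
   Context: For a finite set $A$ and a positive integer $n$, $B_n(A)=\mathrm{Sym}(A^n)$ is the group of bijections $A^n\to A^n$ and $B(A)=\bigcup_n B_n(A)$; its elements are called gates. For $\alpha\in S_n$, the wire permutation is $\pi_\alpha(x_1,\dots,x_n)=(x_{\alpha^{ -1}(1)},\dots,x_{\alpha^{ -1}(n)})$; a rewiring of $f\in B_n(A)$ is $\pi_\alpha\circ f\circ\pi_\alpha^{ -1}$ for some $\alpha\in S_n$. For $f\in B_n(A)$, $g\in B_m(A)$, $f\oplus g\in B_{n+m}(A)$ applies $f$ to the first $n$ coordinates and $g$ to the last $m$; $\mathrm{id}_k$ is the identity of $A^k$. The extensions of $f\in B_\ell(A)$ on $A^n$, $n\ge\ell$, are the rewirings of $f\oplus \mathrm{id}_{n-\ell}$. For $P\subseteq B(A)$, $\lceil P\rceil\subseteq B(A)$ is the set of all gates obtained from $\mathrm{id}_1$ and the elements of $P$ by compositions of gates of equal arity and extensions. A set $C\subseteq B(A)$ with $C=\lceil C\rceil$ is called a revital; it is finitely generated if $C=\lceil P\rceil$ for some finite $P$. The weight of a word $x\in A^n$ is the function $w_n(x)\in\mathbb N^A$ where $w_n(x)(a)$ is the number of occurrences of $a$ in $x$. A gate $f\in B_n(A)$ is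 conservative if $w_n(f(x))=w_n(x)$ for all $x\in A^n$. $Cons(A)$ is the set of all conservative gates of all arities. -}

module Defs where

open import Data.Fin.Base using (Fin)
open import Data.Fin.Permutation using (Permutation′; _⟨$⟩ˡ_; inverseʳ; inverseˡ; flip)
open import Data.Fin.Properties using (inj⇒≟)
open import Data.List.Base using (List)
import Data.List.Membership.Propositional as List
open import Data.Nat.Base using (ℕ; suc; _+_)
open import Data.Product.Base using (Σ-syntax; _,_; proj₁; proj₂)
open import Data.Vec.Base using (Vec; _++_; take; drop; lookup; tabulate; count)
open import Data.Vec.Properties
  using (++-injective; take++drop≡id; lookup∘tabulate; tabulate∘lookup; tabulate-cong)
open import Function.Bundles using (_↔_; Inverse; mk↔ₛ′)
open import Function.Construct.Composition using (_↔-∘_)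
open import Function.Construct.Identity using (↔-id)
open import Function.Construct.Symmetry using (↔-sym)
open import Function.Properties.Inverse using (↔⇒↣)
open import Level using (Level; _⊔_)
open import Relation.Binary.Definitions using (DecidableEquality)
open import Relation.Binary.PropositionalEquality
  using (_≡_; _≗_; trans; cong; cong₂)
open import Relation.Unary using (Pred; _∈_; _≐_)

private
  variable
    a ℓ : Level
    A : Set a
    m n : ℕ

take-++ : (xs : Vec A m) (ys : Vec A n) → take m (xs ++ ys) ≡ xs
take-++ {m = m} xs ys =
  proj₁ (++-injective (take m (xs ++ ys)) xs (take++drop≡id m (xs ++ ys)))

drop-++ : (xs : Vec A m) (ys : Vec A n) → drop m (xs ++ ys) ≡ ys
drop-++ {m = m} xs ys =
  proj₂ (++-injective (take m (xs ++ ys)) xs (take++drop≡id m (xs ++ ys)))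

------------------------------------------------------------------------
-- Bijections of Aⁿ

Sym^ : Set a → ℕ → Set a
Sym^ A n = Vec A n ↔ Vec A n

wire : Permutation′ n → Vec A n → Vec A n
wire α x = tabulate (λ i → lookup x (α ⟨$⟩ˡ i))

wire-cancel : (α β : Permutation′ n) → (∀ i → β ⟨$⟩ˡ (α ⟨$⟩ˡ i) ≡ i) →
              (x : Vec A n) → wire α (wire β x) ≡ x
wire-cancel α β eq x = trans
  (tabulate-cong λ i → trans (lookup∘tabulate _ (α ⟨$⟩ˡ i)) (cong (lookup x) (eq i)))
  (tabulate∘lookup x)

π[_] : Permutation′ n → Sym^ A n
π[ α ] = mk↔ₛ′ (wire α) (wire (flip α))
  (wire-cancel α (flip α) (λ _ → inverseʳ α))
  (wire-cancel (flip α) α (λ _ → inverseˡ α))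

infixr 6 _⊕_

_⊕_ : Sym^ A m → Sym^ A n → Sym^ A (m + n)
_⊕_ {A = A} {m = m} {n = n} f g = mk↔ₛ′
  (both F.to G.to) (both F.from G.from)
  (both-cancel F.to F.from G.to G.from F.strictlyInverseˡ G.strictlyInverseˡ)
  (both-cancel F.from F.to G.from G.to F.strictlyInverseʳ G.strictlyInverseʳ)
  where
  module F = Inverse f
  module G = Inverse g

  both : (Vec A m → Vec A m) → (Vec A n → Vec A n) → Vec A (m + n) → Vec A (m + n)
  both h k x = h (take m x) ++ k (drop m x)

  both-cancel : ∀ h h′ k k′ → (∀ y → h (h′ y) ≡ y) → (∀ z → k (k′ z) ≡ z) →
                ∀ x → both h k (both h′ k′ x) ≡ x
  both-cancel h h′ k k′ hh′ kk′ x = trans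
    (cong₂ _++_
      (trans (cong h (take-++ (h′ (take m x)) (k′ (drop m x)))) (hh′ (take m x)))
      (trans (cong k (drop-++ (h′ (take m x)) (k′ (drop m x)))) (kk′ (drop m x))))
    (take++drop≡id m x)

rewiring : Permutation′ n → Sym^ A n → Sym^ A n
rewiring α f = π[ α ] ↔-∘ (f ↔-∘ ↔-sym π[ α ])

------------------------------------------------------------------------
-- Gates

-- Arities are positive: (n , f) is a gate of arity suc n.

Gate : Set a → Set a
Gate A = Σ[ n ∈ ℕ ] Sym^ A (suc n)

infixl 6 _⊕id_

_⊕id_ : Gate A → ℕ → Gate A
(n , f) ⊕id k = n + k , f ⊕ ↔-id (Vec _ k)

-- Gates are compared as functions.  The constructor resp closes ⌈ P ⌉
-- under pointwise equality, so P itself need not respect it.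

data ⌈_⌉ {A : Set a} (P : Pred (Gate A) ℓ) : Pred (Gate A) (a ⊔ ℓ) where
  id₁       : (0 , ↔-id (Vec A 1)) ∈ ⌈ P ⌉
  generator : ∀ {g} → g ∈ P → g ∈ ⌈ P ⌉
  compose   : ∀ {n} {f g : Sym^ A (suc n)} →
              (n , f) ∈ ⌈ P ⌉ → (n , g) ∈ ⌈ P ⌉ → (n , f ↔-∘ g) ∈ ⌈ P ⌉
  extension : ∀ {n} {f : Sym^ A (suc n)} → (n , f) ∈ ⌈ P ⌉ →
              ∀ k (α : Permutation′ (suc n + k)) →
              (n + k , rewiring α (f ⊕ ↔-id (Vec A k))) ∈ ⌈ P ⌉
  resp      : ∀ {n} {f g : Sym^ A (suc n)} →
              Inverse.to f ≗ Inverse.to g → (n , f) ∈ ⌈ P ⌉ → (n , g) ∈ ⌈ P ⌉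

IsRevital : {A : Set a} → Pred (Gate A) ℓ → Set (a ⊔ ℓ)
IsRevital C = C ≐ ⌈ C ⌉

FinitelyGenerated : {A : Set a} → Pred (Gate A) ℓ → Set (a ⊔ ℓ)
FinitelyGenerated {A = A} C = Σ[ P ∈ List (Gate A) ] C ≐ ⌈ (λ g → g List.∈ P) ⌉

------------------------------------------------------------------------
-- Conservative gates over a finite set

module _ {A : Set a} {q : ℕ} (enum : A ↔ Fin q) where

  ≟-from-enum : DecidableEquality A
  ≟-from-enum = inj⇒≟ (↔⇒↣ enum)

  weight : Vec A n → A → ℕ
  weight x b = count (≟-from-enum b) x

  Cons : Pred (Gate A) a
  Cons (n , f) = ∀ x → weight (Inverse.to f x) ≗ weight x

{-# OPTIONS --safe #-}

-- Fix two letters a, b. The signs of a conservative gate f of arity n on the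
-- sets of words with n ∸ r letters a and r letters b are the coefficients of a
-- polynomial s_f(t) over 𝔽₂. Composition adds these polynomials, rewiring
-- preserves them, and s_{f ⊕ id_k} = (1 + t)ᵏ s_f. Hence, when all generators
-- have arity at most M, the polynomial of every generated gate of arity n ≥ M is
-- divisible by (1 + t)ⁿ⁻ᴹ. The transposition f of a b aᴺ and b a aᴺ has arity
-- M + 1 = N + 2 and s_f = t, so t (1 + t)ᵏ, which is not divisible by
-- (1 + t)ᵏ⁺¹, shows that f ⊕ id_k is never generated. Divisibility is tested by
-- one Hasse derivative at t = 1, and signs are computed by counting inversions.

module Submission where

open import Defs
open import Level using (Level)
open import Data.Nat.Base using (ℕ; _<_)
open import Data.Fin.Base using (Fin)
open import Data.Product.Base using (_×_; ∃-syntax)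
open import Function.Bundles using (_↔_)
open import Relation.Nullary.Negation using (¬_)
open import Relation.Unary using (Pred; _∈_; _∉_; _⊆_)

open import Data.Nat.Properties
open import Algebra.Properties.Semiring.Sum +-*-semiring
  using (sum; sum-cong-≗; sum-permute; sum-replicate-zero; ∑-distrib-+; ∑-comm; *-distribˡ-sum)
open import Data.Bool.Base using (Bool; true; false; not; _∧_; _xor_; if_then_else_)
open import Data.Bool.Properties using (xor-same; xor-comm)
open import Data.Fin.Base using (zero; suc)
open import Data.Fin.Permutation using (Permutation′; _⟨$⟩ˡ_; flip)
import Data.Fin.Properties as Fin
open import Data.List.Base using (List; []; _∷_)
import Data.List.Membership.Propositional as List
open import Data.List.Relation.Unary.Any using (here; there)
open import Data.Nat.Base using (zero; suc; _+_; _*_; _∸_; _≤_; _⊔_; _≡ᵇ_; s≤s; z≤n)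
open import Data.Nat.Combinatorics using (_C_; nCk+nC[k+1]≡[n+1]C[k+1])
open import Data.Nat.Divisibility
  using (_∣_; _∣0; ∣m∣n⇒∣m+n; ∣m+n∣m⇒∣n; m∣m*n; *-cancelˡ-∣; ∣1⇒≡1)
open import Data.Nat.Solver using (module +-*-Solver)
open import Data.Product.Base using (_,_; proj₁; proj₂)
open import Data.Vec.Base using (Vec; []; _∷_; _++_; lookup; count; replicate)
open import Data.Vec.Properties using (≡-dec; lookup∘tabulate; ∷-injectiveˡ; ++-injectiveˡ; ++-injectiveʳ)
open import Function.Base using (_∘_; id)
open import Function.Bundles using (Injection; Inverse; mk⇔; mk↔ₛ′)
open import Function.Construct.Composition using (_↔-∘_)
open import Function.Construct.Identity using (↔-id)
open import Function.Construct.Symmetry using (↔-sym)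
open import Function.Properties.Inverse using (↔⇒↣)
open import Relation.Binary.Definitions using (DecidableEquality; tri<; tri≈; tri>)
open import Relation.Binary.PropositionalEquality
open import Relation.Nullary.Decidable using (yes; no; does; dec-true; dec-false; does-⇔)
open import Relation.Nullary.Negation using (contradiction)
import Relation.Unary as Unary

open +-*-Solver using (solve; _:=_; _:+_; _:*_; con)
open ≡-Reasoning

-- Truth values as numbers, and letter counts

⟦_⟧ : Bool → ℕ
⟦ true ⟧  = 1
⟦ false ⟧ = 0

⟦∧⟧ : ∀ b c → ⟦ b ∧ c ⟧ ≡ ⟦ b ⟧ * ⟦ c ⟧
⟦∧⟧ true  c = sym (+-identityʳ ⟦ c ⟧)
⟦∧⟧ false c = refl

-- Makes inversion counts additive under composition up to an even error. The correction stands on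
-- the left to avoid subtraction in `ℕ`.
⟦xor⟧ : ∀ b c → ⟦ b xor c ⟧ + 2 * ⟦ b ∧ c ⟧ ≡ ⟦ b ⟧ + ⟦ c ⟧
⟦xor⟧ true  true  = refl
⟦xor⟧ true  false = refl
⟦xor⟧ false c     = +-identityʳ ⟦ c ⟧

not-xor-not : ∀ b c → not b xor not c ≡ b xor c
not-xor-not true  true  = refl
not-xor-not true  false = refl
not-xor-not false true  = refl
not-xor-not false false = refl

-- Splits an inversion of a composite map at the intermediate pair of words.
xor-telescope : ∀ b c d → b xor d ≡ (b xor c) xor (c xor d)
xor-telescope true  true  d     = refl
xor-telescope true  false true  = refl
xor-telescope true  false false = refl
xor-telescope false true  true  = refl
xor-telescope false true  false = refl
xor-telescope false false d     = refl

count-∷ : ∀ {a p} {A : Set a} {P : Pred A p} (P? : Unary.Decidable P) {n} x (xs : Vec A n) →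
          count P? (x ∷ xs) ≡ ⟦ does (P? x) ⟧ + count P? xs
count-∷ P? x xs with does (P? x)
... | true  = refl
... | false = refl

count-++ : ∀ {a p} {A : Set a} {P : Pred A p} (P? : Unary.Decidable P) {m n}
           (xs : Vec A m) (ys : Vec A n) → count P? (xs ++ ys) ≡ count P? xs + count P? ys
count-++ P? []       ys = refl
count-++ P? (x ∷ xs) ys with does (P? x)
... | true  = cong suc (count-++ P? xs ys)
... | false = count-++ P? xs ys

count≡sum : ∀ {a p} {A : Set a} {P : Pred A p} (P? : Unary.Decidable P) {n} (xs : Vec A n) →
            count P? xs ≡ sum (λ i → ⟦ does (P? (lookup xs i)) ⟧)
count≡sum P? []       = refl
count≡sum P? (x ∷ xs) = trans (count-∷ P? x xs) (cong (⟦ does (P? x) ⟧ +_) (count≡sum P? xs))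

-- A count is a sum over positions, which a wire permutation merely permutes. Positions are read
-- through the inverse of `α`, hence `flip`.
count-wire : ∀ {a p} {A : Set a} {P : Pred A p} (P? : Unary.Decidable P) {n}
             (α : Permutation′ n) (xs : Vec A n) → count P? (wire α xs) ≡ count P? xs
count-wire P? α xs = begin
  count P? (wire α xs)
    ≡⟨ count≡sum P? (wire α xs) ⟩
  sum (λ i → ⟦ does (P? (lookup (wire α xs) i)) ⟧)
    ≡⟨ sum-cong-≗ (λ i → cong (λ y → ⟦ does (P? y) ⟧) (lookup∘tabulate (λ i → lookup xs (α ⟨$⟩ˡ i)) i)) ⟩
  sum (λ i → ⟦ does (P? (lookup xs (α ⟨$⟩ˡ i))) ⟧)
    ≡⟨ sum-permute (λ i → ⟦ does (P? (lookup xs i)) ⟧) (flip α) ⟨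
  sum (λ i → ⟦ does (P? (lookup xs i)) ⟧)
    ≡⟨ count≡sum P? xs ⟨
  count P? xs ∎

-- Binomial coefficients as Hasse derivatives, and the kernel built from them

≢⇒≡ᵇ : ∀ {m n} → m ≢ n → (m ≡ᵇ n) ≡ false
≢⇒≡ᵇ {m} {n} = dec-false (m ≟ n)

≡ᵇ-refl : ∀ n → (n ≡ᵇ n) ≡ true
≡ᵇ-refl n = dec-true (n ≟ n) refl

-- For i > 0, the Hasse derivative of order i ∸ 1 of the monomial tʳ at t = 1.
binom : ℕ → ℕ → ℕ
binom zero    r = 0
binom (suc i) r = r C i

-- The Leibniz rule for (1 + t) tʳ at t = 1. Modulo 2 the factor 1 + t vanishes there, so
-- multiplying by it lowers the order of the derivative by one.
binom-suc : ∀ i r → binom (suc i) r + binom (suc i) (suc r) ≡ binom i r + 2 * binom (suc i) r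
binom-suc zero    r = refl
binom-suc (suc i) r = begin
  r C suc i + suc r C suc i          ≡⟨ cong (r C suc i +_) (nCk+nC[k+1]≡[n+1]C[k+1] r i) ⟨
  r C suc i + (r C i + r C suc i)    ≡⟨ solve 2 (λ x y → x :+ (y :+ x) := y :+ con 2 :* x) refl (r C suc i) (r C i) ⟩
  r C i + 2 * (r C suc i)            ∎

-- For m ≥ M this is `binom-suc` at m ∸ M; for m < M both truncated differences are 0, where `binom`
-- vanishes.
binom-∸-suc : ∀ M m r → binom (suc m ∸ M) r + binom (suc m ∸ M) (suc r) ≡
                        binom (m ∸ M) r + 2 * binom (suc m ∸ M) r
binom-∸-suc zero    m       r = binom-suc m r
binom-∸-suc (suc M) zero    r rewrite 0∸n≡0 M = refl
binom-∸-suc (suc M) (suc m) r = binom-∸-suc M m r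

-- The arguments p, r and p′, r′ are the numbers of letters a, b in two words of
-- length n; the truncated n ∸ M makes the kernel vanish for n ≤ M.
kernel : (M n p r p′ r′ : ℕ) → ℕ
kernel M n p r p′ r′ =
  if (p ≡ᵇ p′) ∧ (r ≡ᵇ r′) ∧ (p + r ≡ᵇ n) then binom (n ∸ M) r else 0

kernel-sym : ∀ M n p r p′ r′ → kernel M n p r p′ r′ ≡ kernel M n p′ r′ p r
kernel-sym M n p r p′ r′ with p ≟ p′ | r ≟ r′
... | yes refl | yes refl = refl
... | yes refl | no r≢r′
  rewrite ≡ᵇ-refl p | ≢⇒≡ᵇ r≢r′ | ≢⇒≡ᵇ (≢-sym r≢r′) = refl
... | no p≢p′  | _
  rewrite ≢⇒≡ᵇ p≢p′ | ≢⇒≡ᵇ (≢-sym p≢p′) = refl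

kernel-short : ∀ M {n} p r p′ r′ → n ≤ M → kernel M n p r p′ r′ ≡ 0
kernel-short M {n} p r p′ r′ n≤M
  rewrite m≤n⇒m∸n≡0 n≤M
  with (p ≡ᵇ p′) ∧ (r ≡ᵇ r′) ∧ (p + r ≡ᵇ n)
... | true  = refl
... | false = refl

-- The case of a letter other than a and b: the counts p and r cannot fill a word of length m + 1,
-- so the length test fails.
kernel-other : ∀ M m p r p′ r′ → p + r ≤ m → kernel M (suc m) p r p′ r′ ≡ 0
kernel-other M m p r p′ r′ p+r≤m
  rewrite ≢⇒≡ᵇ {p + r} {suc m} (λ eq → 1+n≰n (subst (_≤ m) eq p+r≤m))
  with p ≡ᵇ p′ | r ≡ᵇ r′
... | true  | true  = refl
... | true  | false = refl
... | false | _     = refl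

-- Pascal's rule when both words gain a letter a or both gain a letter b; all three length tests
-- agree. The congruence modulo 2 carries a witness because errors are later summed and shown to be
-- symmetric.
kernel-suc : ∀ M m p r p′ r′ →
  ∃[ d ] kernel M (suc m) (suc p) r (suc p′) r′ + kernel M (suc m) p (suc r) p′ (suc r′) ≡
         kernel M m p r p′ r′ + 2 * d
kernel-suc M m p r p′ r′
  rewrite +-suc p r
  with (p ≡ᵇ p′) ∧ (r ≡ᵇ r′) ∧ (p + r ≡ᵇ m)
... | true  = binom (suc m ∸ M) r , binom-∸-suc M m r
... | false = 0 , refl

-- At length M + 1 the derivative has order 0, so every monomial has value 1.
kernel-diag : ∀ M p r → p + r ≡ suc M → kernel M (suc M) p r p r ≡ 1
kernel-diag M p r eq
  rewrite eq | ≡ᵇ-refl p | ≡ᵇ-refl r | ≡ᵇ-refl M | +-∸-assoc 1 (≤-refl {M}) | n∸n≡0 M = refl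

-- Finite sums and sums over all words

sum-zero : ∀ {n} {f : Fin n → ℕ} → (∀ i → f i ≡ 0) → sum f ≡ 0
sum-zero {n} f≡0 = trans (sum-cong-≗ f≡0) (sum-replicate-zero n)

sum-δ : ∀ {n} (j : Fin n) (f : Fin n → ℕ) → sum (λ i → ⟦ does (j Fin.≟ i) ⟧ * f i) ≡ f j
sum-δ zero    f = trans
  (cong₂ _+_ (*-identityˡ (f zero)) (sum-zero {f = λ i → 0 * f (suc i)} λ _ → refl))
  (+-identityʳ (f zero))
sum-δ (suc j) f = sum-δ j (f ∘ suc)

module Words {a} {A : Set a} {q : ℕ} (enum : A ↔ Fin q) where

  open Inverse enum using () renaming
    (to to index; from to letter; strictlyInverseˡ to index-letter; strictlyInverseʳ to letter-index)

  private
    variable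
      m n : ℕ

  infix 4 _≟ᴬ_ _≟ʷ_

  _≟ᴬ_ : DecidableEquality A
  _≟ᴬ_ = ≟-from-enum enum

  _≟ʷ_ : DecidableEquality (Vec A n)
  _≟ʷ_ = ≡-dec _≟ᴬ_

  ∑ : (Vec A n → ℕ) → ℕ
  ∑ {zero}  F = F []
  ∑ {suc n} F = sum (λ i → ∑ (λ x → F (letter i ∷ x)))

  ∑-cong : {F G : Vec A n → ℕ} → F ≗ G → ∑ F ≡ ∑ G
  ∑-cong {zero}  F≗G = F≗G []
  ∑-cong {suc n} F≗G = sum-cong-≗ λ i → ∑-cong λ x → F≗G (letter i ∷ x)

  ∑-+ : (F G : Vec A n → ℕ) → ∑ (λ x → F x + G x) ≡ ∑ F + ∑ G
  ∑-+ {zero}  F G = refl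
  ∑-+ {suc n} F G = trans
    (sum-cong-≗ λ i → ∑-+ (λ x → F (letter i ∷ x)) (λ x → G (letter i ∷ x)))
    (∑-distrib-+ (λ i → ∑ (λ x → F (letter i ∷ x))) (λ i → ∑ (λ x → G (letter i ∷ x))))

  ∑-*ˡ : ∀ c (F : Vec A n → ℕ) → ∑ (λ x → c * F x) ≡ c * ∑ F
  ∑-*ˡ {zero}  c F = refl
  ∑-*ˡ {suc n} c F = trans
    (sum-cong-≗ λ i → ∑-*ˡ c (λ x → F (letter i ∷ x)))
    (sym (*-distribˡ-sum c (λ i → ∑ (λ x → F (letter i ∷ x)))))

  ∑-zero : {F : Vec A n → ℕ} → (∀ x → F x ≡ 0) → ∑ F ≡ 0
  ∑-zero {n} F≡0 = trans (∑-cong F≡0) (∑-*ˡ {n} 0 (λ _ → 0))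

  sum-∑-comm : ∀ {k} (F : Fin k → Vec A n → ℕ) →
               sum (λ i → ∑ (F i)) ≡ ∑ (λ x → sum (λ i → F i x))
  sum-∑-comm {zero}  F = refl
  sum-∑-comm {suc n} F = trans
    (∑-comm (λ i j → ∑ (λ x → F i (letter j ∷ x))))
    (sum-cong-≗ λ j → sum-∑-comm (λ i x → F i (letter j ∷ x)))

  ∑-swap : (F : Vec A m → Vec A n → ℕ) →
           ∑ (λ x → ∑ (λ y → F x y)) ≡ ∑ (λ y → ∑ (λ x → F x y))
  ∑-swap {zero}  F = refl
  ∑-swap {suc m} F = trans
    (sum-cong-≗ λ i → ∑-swap (λ x y → F (letter i ∷ x) y))
    (sum-∑-comm (λ i y → ∑ (λ x → F (letter i ∷ x) y)))

  ∑-++ : ∀ m {n} (F : Vec A (m + n) → ℕ) → ∑ F ≡ ∑ (λ v → ∑ (λ (u : Vec A m) → F (u ++ v)))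
  ∑-++ zero    F = refl
  ∑-++ (suc m) {n} F = trans
    (sum-cong-≗ λ i → ∑-++ m (λ x → F (letter i ∷ x)))
    (sum-∑-comm (λ i (v : Vec A n) → ∑ (λ (u : Vec A m) → F (letter i ∷ u ++ v))))

  ∑-δ : (z : Vec A n) (F : Vec A n → ℕ) → ∑ (λ x → ⟦ does (z ≟ʷ x) ⟧ * F x) ≡ F z
  ∑-δ []      F = *-identityˡ (F [])
  ∑-δ (c ∷ z) F = begin
    sum (λ i → ∑ (λ x → ⟦ does (c ≟ᴬ letter i) ∧ does (z ≟ʷ x) ⟧ * F (letter i ∷ x)))
      ≡⟨ sum-cong-≗ (λ i → trans (∑-cong (split i)) (∑-*ˡ ⟦ does (c ≟ᴬ letter i) ⟧ (λ x → ⟦ does (z ≟ʷ x) ⟧ * F (letter i ∷ x)))) ⟩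
    sum (λ i → ⟦ does (c ≟ᴬ letter i) ⟧ * ∑ (λ x → ⟦ does (z ≟ʷ x) ⟧ * F (letter i ∷ x)))
      ≡⟨ sum-cong-≗ (λ i → cong₂ (λ j s → ⟦ does (index c Fin.≟ j) ⟧ * s) (index-letter i) (∑-δ z (λ x → F (letter i ∷ x)))) ⟩
    sum (λ i → ⟦ does (index c Fin.≟ i) ⟧ * F (letter i ∷ z))
      ≡⟨ sum-δ (index c) (λ i → F (letter i ∷ z)) ⟩
    F (letter (index c) ∷ z)
      ≡⟨ cong (λ d → F (d ∷ z)) (letter-index c) ⟩
    F (c ∷ z) ∎
    where
    split : ∀ i x → ⟦ does (c ≟ᴬ letter i) ∧ does (z ≟ʷ x) ⟧ * F (letter i ∷ x) ≡
                    ⟦ does (c ≟ᴬ letter i) ⟧ * (⟦ does (z ≟ʷ x) ⟧ * F (letter i ∷ x))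
    split i x = trans
      (cong (_* F (letter i ∷ x)) (⟦∧⟧ (does (c ≟ᴬ letter i)) (does (z ≟ʷ x))))
      (*-assoc ⟦ does (c ≟ᴬ letter i) ⟧ ⟦ does (z ≟ʷ x) ⟧ (F (letter i ∷ x)))

  -- Expanding F at the image of x as a sum against a delta function allows the two sums to be
  -- exchanged; the delta then collapses on the other side, because f x = y exactly when x is the
  -- preimage of y.
  ∑-reindex : (f : Sym^ A n) (F : Vec A n → ℕ) → ∑ (λ x → F (Inverse.to f x)) ≡ ∑ F
  ∑-reindex f F = begin
    ∑ (λ x → F (to x))
      ≡⟨ ∑-cong (λ x → ∑-δ (to x) F) ⟨
    ∑ (λ x → ∑ (λ y → ⟦ does (to x ≟ʷ y) ⟧ * F y))
      ≡⟨ ∑-swap (λ x y → ⟦ does (to x ≟ʷ y) ⟧ * F y) ⟩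
    ∑ (λ y → ∑ (λ x → ⟦ does (to x ≟ʷ y) ⟧ * F y))
      ≡⟨ ∑-cong (λ y → ∑-cong (λ x → cong (λ b → ⟦ b ⟧ * F y) (adjoint x y))) ⟩
    ∑ (λ y → ∑ (λ x → ⟦ does (from y ≟ʷ x) ⟧ * F y))
      ≡⟨ ∑-cong (λ y → ∑-δ (from y) (λ _ → F y)) ⟩
    ∑ F ∎
    where
    open Inverse f using (to; from; strictlyInverseˡ; strictlyInverseʳ)

    adjoint : ∀ x y → does (to x ≟ʷ y) ≡ does (from y ≟ʷ x)
    adjoint x y = does-⇔
      (mk⇔ (λ eq → trans (cong from (sym eq)) (strictlyInverseʳ x))
           (λ eq → trans (cong to (sym eq)) (strictlyInverseˡ y)))
      (to x ≟ʷ y) (from y ≟ʷ x)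

  ∑² : (Vec A n → Vec A n → ℕ) → ℕ
  ∑² F = ∑ (λ x → ∑ (F x))

  ∑²-cong : {F G : Vec A n → Vec A n → ℕ} → (∀ x y → F x y ≡ G x y) → ∑² F ≡ ∑² G
  ∑²-cong F≡G = ∑-cong λ x → ∑-cong (F≡G x)

  ∑²-+ : (F G : Vec A n → Vec A n → ℕ) → ∑² (λ x y → F x y + G x y) ≡ ∑² F + ∑² G
  ∑²-+ F G = trans (∑-cong λ x → ∑-+ (F x) (G x)) (∑-+ (λ x → ∑ (F x)) (λ x → ∑ (G x)))

  ∑²-*ˡ : ∀ c (F : Vec A n → Vec A n → ℕ) → ∑² (λ x y → c * F x y) ≡ c * ∑² F
  ∑²-*ˡ c F = trans (∑-cong λ x → ∑-*ˡ c (F x)) (∑-*ˡ c (λ x → ∑ (F x)))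

  ∑²-reindex : (f : Sym^ A n) (F : Vec A n → Vec A n → ℕ) →
               ∑² (λ x y → F (Inverse.to f x) (Inverse.to f y)) ≡ ∑² F
  ∑²-reindex f F = trans
    (∑-cong λ x → ∑-reindex f (F (Inverse.to f x)))
    (∑-reindex f (λ x → ∑ (F x)))

  ∑²-symmetrized : (G : Vec A n → Vec A n → ℕ) → ∑² (λ x y → G x y + G y x) ≡ 2 * ∑² G
  ∑²-symmetrized G = begin
    ∑² (λ x y → G x y + G y x)       ≡⟨ ∑²-+ G (λ x y → G y x) ⟩
    ∑² G + ∑² (λ x y → G y x)        ≡⟨ cong (∑² G +_) (∑-swap G) ⟨
    ∑² G + ∑² G                      ≡⟨ cong (∑² G +_) (+-identityʳ (∑² G)) ⟨
    2 * ∑² G                         ∎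

  -- Comparison of words and inverted pairs

  -- A tournament on words, decided at the last position where they differ.
  -- Thus u ++ v and u′ ++ v′ with v ≢ v′ are compared by v and v′ alone.
  before : Vec A n → Vec A n → Bool
  before []      []      = false
  before (c ∷ x) (d ∷ y) =
    if does (x ≟ʷ y) then does (index c Fin.<? index d) else before x y

  before-irrefl : (x : Vec A n) → before x x ≡ false
  before-irrefl []      = refl
  before-irrefl (c ∷ x)
    rewrite dec-true (x ≟ʷ x) refl = dec-false (index c Fin.<? index c) (<-irrefl refl)

  before-flip : {x y : Vec A n} → x ≢ y → before y x ≡ not (before x y)
  before-flip {x = []}    {[]}    x≢y = contradiction refl x≢y
  before-flip {x = c ∷ x} {d ∷ y} cx≢dy with x ≟ʷ y
  ... | no x≢y
    rewrite dec-false (y ≟ʷ x) (≢-sym x≢y) = before-flip x≢y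
  ... | yes refl
    rewrite dec-true (x ≟ʷ x) refl
    with Fin.<-cmp (index c) (index d)
  ... | tri< c<d _ d≮c
    rewrite dec-true (index c Fin.<? index d) c<d = dec-false (index d Fin.<? index c) d≮c
  ... | tri> c≮d _ d<c
    rewrite dec-false (index c Fin.<? index d) c≮d = dec-true (index d Fin.<? index c) d<c
  ... | tri≈ _ eq _ =
    contradiction (cong (_∷ x) (Injection.injective (↔⇒↣ enum) eq)) cx≢dy

  before-++ : (u u′ : Vec A m) (v v′ : Vec A n) →
              before (u ++ v) (u′ ++ v′) ≡ (if does (v ≟ʷ v′) then before u u′ else before v v′)
  before-++ [] [] v v′ with v ≟ʷ v′
  ... | yes refl = before-irrefl v
  ... | no _     = refl
  before-++ (c ∷ u) (d ∷ u′) v v′ with v ≟ʷ v′ | before-++ u u′ v v′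
  ... | yes refl | eq
    rewrite does-⇔ (mk⇔ (++-injectiveˡ u u′) (cong (_++ v))) (u ++ v ≟ʷ u′ ++ v) (u ≟ʷ u′)
          | eq = refl
  ... | no v≢v′ | eq
    rewrite dec-false (u ++ v ≟ʷ u′ ++ v′) (v≢v′ ∘ ++-injectiveʳ u u′) = eq

  -- Off the diagonal each unordered pair is counted twice with equal value; the tournament `before`
  -- selects one of its two orderings.
  ∑²-even : (F : Vec A n → Vec A n → ℕ) → (∀ x y → F x y ≡ F y x) → (∀ x → F x x ≡ 0) →
            ∃[ c ] ∑² F ≡ 2 * c
  ∑²-even F F-sym F-diag = ∑² G , trans (∑²-cong split) (∑²-symmetrized G)
    where
    G : Vec A _ → Vec A _ → ℕ
    G x y = ⟦ before x y ⟧ * F x y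

    split : ∀ x y → F x y ≡ G x y + G y x
    split x y with x ≟ʷ y
    ... | yes refl
      rewrite F-diag x | *-zeroʳ ⟦ before x x ⟧ = refl
    ... | no x≢y
      rewrite before-flip x≢y | F-sym y x with before x y
    ... | true  = solve 1 (λ s → s := con 1 :* s :+ con 0 :* s) refl (F x y)
    ... | false = solve 1 (λ s → s := con 0 :* s :+ con 1 :* s) refl (F x y)

  inverts : (Vec A n → Vec A n) → Vec A n → Vec A n → Bool
  inverts g x y = before x y xor before (g x) (g y)

  inverts-diag : (g : Vec A n → Vec A n) → ∀ x → inverts g x x ≡ false
  inverts-diag g x rewrite before-irrefl x = before-irrefl (g x)

  -- Exchanging two distinct words negates both comparisons, since their images are distinct too,
  -- and the exclusive or is unchanged.
  inverts-sym : (g : Sym^ A n) → ∀ x y → inverts (Inverse.to g) x y ≡ inverts (Inverse.to g) y x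
  inverts-sym g x y with x ≟ʷ y
  ... | yes refl = refl
  ... | no x≢y
    rewrite before-flip x≢y
          | before-flip {x = Inverse.to g x} (x≢y ∘ Injection.injective (↔⇒↣ g)) =
    sym (not-xor-not (before x y) _)

  -- Words with different suffixes are compared by these suffixes, which the gate fixes, so only
  -- pairs with a common suffix can be inverted.
  inverts-⊕ : (f : Sym^ A m) (u u′ : Vec A m) (v v′ : Vec A n) →
              ⟦ inverts (Inverse.to (f ⊕ ↔-id (Vec A n))) (u ++ v) (u′ ++ v′) ⟧ ≡
              ⟦ does (v ≟ʷ v′) ⟧ * ⟦ inverts (Inverse.to f) u u′ ⟧
  inverts-⊕ f u u′ v v′
    rewrite take-++ u v | drop-++ u v | take-++ u′ v′ | drop-++ u′ v′
          | before-++ u u′ v v′ | before-++ (Inverse.to f u) (Inverse.to f u′) v v′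
    with does (v ≟ʷ v′)
  ... | true  = sym (+-identityʳ _)
  ... | false = cong ⟦_⟧ (xor-same (before v v′))

  -- Transpositions of words and conservative maps

  transposeʷ : (u w : Vec A n) → Vec A n → Vec A n
  transposeʷ u w z = if does (u ≟ʷ z) then w else if does (w ≟ʷ z) then u else z

  transposeʷ-involutive : (u w : Vec A n) → ∀ z → transposeʷ u w (transposeʷ u w z) ≡ z
  transposeʷ-involutive u w z with u ≟ʷ z | w ≟ʷ z in w?z
  ... | yes refl | yes refl rewrite w?z = refl
  ... | yes refl | no w≢z
    rewrite dec-false (u ≟ʷ w) (≢-sym w≢z) | dec-true (w ≟ʷ w) refl = refl
  ... | no u≢z   | yes refl rewrite dec-true (u ≟ʷ u) refl = refl
  ... | no u≢z   | no w≢z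
    rewrite dec-false (u ≟ʷ z) u≢z | dec-false (w ≟ʷ z) w≢z = refl

  transposition : (u w : Vec A n) → Sym^ A n
  transposition u w = mk↔ₛ′ (transposeʷ u w) (transposeʷ u w)
    (transposeʷ-involutive u w) (transposeʷ-involutive u w)

  Conservative : Sym^ A n → Set a
  Conservative f = ∀ x → weight enum (Inverse.to f x) ≗ weight enum x

  wire-conservative : (α : Permutation′ n) → Conservative π[ α ]
  wire-conservative α x c = count-wire (c ≟ᴬ_) α x

  transposition-conservative : (u w : Vec A n) → weight enum u ≗ weight enum w →
                               Conservative (transposition u w)
  transposition-conservative u w eq z c with u ≟ʷ z | w ≟ʷ z
  ... | yes refl | _        = sym (eq c)
  ... | no _     | yes refl = eq c
  ... | no _     | no _     = refl

-- Letter counts of a and b, and the kernel summed over suffixes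

module Sign {a} {A : Set a} {q : ℕ} (enum : A ↔ Fin (suc (suc q))) (M : ℕ) where

  open Words enum public
  open Inverse enum using () renaming
    (to to index; from to letter; strictlyInverseˡ to index-letter; strictlyInverseʳ to letter-index)

  private
    variable
      m n : ℕ

  #a #b : Vec A n → ℕ
  #a x = weight enum x (letter zero)
  #b x = weight enum x (letter (suc zero))

  weight-letter-∷ : ∀ i j (v : Vec A n) →
    weight enum (letter i ∷ v) (letter j) ≡ ⟦ does (j Fin.≟ i) ⟧ + weight enum v (letter j)
  weight-letter-∷ i j v = trans
    (count-∷ (letter j ≟ᴬ_) (letter i) v)
    (cong (λ b → ⟦ b ⟧ + weight enum v (letter j))
      (cong₂ (λ k l → does (k Fin.≟ l)) (index-letter j) (index-letter i)))

  #a+#b≤length : (x : Vec A n) → #a x + #b x ≤ n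
  #a+#b≤length []      = z≤n
  #a+#b≤length (c ∷ x) = subst (λ d → #a (d ∷ x) + #b (d ∷ x) ≤ suc _) (letter-index c) (bound (index c))
    where
    bound : ∀ i → #a (letter i ∷ x) + #b (letter i ∷ x) ≤ suc _
    bound i rewrite weight-letter-∷ i zero x | weight-letter-∷ i (suc zero) x with i
    ... | zero        = s≤s (#a+#b≤length x)
    ... | suc zero    = ≤-trans (≤-reflexive (+-suc (#a x) (#b x))) (s≤s (#a+#b≤length x))
    ... | suc (suc _) = m≤n⇒m≤1+n (#a+#b≤length x)

  -- Two prefixes with counts p, r and p′, r′ share a suffix with s letters a and t letters b.
  shifted : (N p r p′ r′ s t : ℕ) → ℕ
  shifted N p r p′ r′ s t = kernel M N (p + s) (r + t) (p′ + s) (r′ + t)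

  -- Modulo 2: the derivative of order j + k of (1 + t)ᵏ s(t) at t = 1 is the
  -- derivative of order j of s.
  ∑-kernel : ∀ k m p r p′ r′ → p + r ≤ m →
    ∃[ d ] ∑ (λ (v : Vec A k) → shifted (m + k) p r p′ r′ (#a v) (#b v)) ≡
           kernel M m p r p′ r′ + 2 * d
  ∑-kernel zero m p r p′ r′ _
    rewrite +-identityʳ m | +-identityʳ p | +-identityʳ r | +-identityʳ p′ | +-identityʳ r′ =
    0 , sym (+-identityʳ _)
  ∑-kernel (suc k) m p r p′ r′ p+r≤m = d , (begin
    S zero + (S (suc zero) + sum (λ i → S (suc (suc i))))
      ≡⟨ cong₂ _+_ (proj₂ d₀) (cong₂ _+_ (proj₂ d₁) (trans
           (sum-cong-≗ (λ i → proj₂ (d₂ i)))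
           (sym (*-distribˡ-sum 2 (λ i → proj₁ (d₂ i)))))) ⟩
    (K₀ + 2 * proj₁ d₀) + ((K₁ + 2 * proj₁ d₁) + 2 * D₂)
      ≡⟨ solve 5 (λ x y z s t → (x :+ con 2 :* y) :+ ((z :+ con 2 :* s) :+ con 2 :* t) :=
                   (x :+ z) :+ con 2 :* (y :+ (s :+ t)))
           refl K₀ (proj₁ d₀) K₁ (proj₁ d₁) D₂ ⟩
    (K₀ + K₁) + 2 * (proj₁ d₀ + (proj₁ d₁ + D₂))
      ≡⟨ cong (_+ 2 * (proj₁ d₀ + (proj₁ d₁ + D₂))) (proj₂ pascal) ⟩
    (kernel M m p r p′ r′ + 2 * proj₁ pascal) + 2 * (proj₁ d₀ + (proj₁ d₁ + D₂))
      ≡⟨ solve 3 (λ x y z → (x :+ con 2 :* y) :+ con 2 :* z := x :+ con 2 :* (y :+ z))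
           refl (kernel M m p r p′ r′) (proj₁ pascal) (proj₁ d₀ + (proj₁ d₁ + D₂)) ⟩
    kernel M m p r p′ r′ + 2 * d ∎)
    where
    S : Fin (suc (suc q)) → ℕ
    S i = ∑ (λ (v : Vec A k) → shifted (m + suc k) p r p′ r′ (#a (letter i ∷ v)) (#b (letter i ∷ v)))

    K₀ K₁ : ℕ
    K₀ = kernel M (suc m) (suc p) r (suc p′) r′
    K₁ = kernel M (suc m) p (suc r) p′ (suc r′)

    S-letter : ∀ i → S i ≡ ∑ (λ (v : Vec A k) → shifted (suc m + k) p r p′ r′
                 (⟦ does (zero Fin.≟ i) ⟧ + #a v) (⟦ does (suc zero Fin.≟ i) ⟧ + #b v))
    S-letter i = ∑-cong λ (v : Vec A k) → trans
      (cong (λ N → shifted N p r p′ r′ (#a (letter i ∷ v)) (#b (letter i ∷ v))) (+-suc m k))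
      (cong₂ (shifted (suc m + k) p r p′ r′) (weight-letter-∷ i zero v) (weight-letter-∷ i (suc zero) v))

    d₀ : ∃[ d ] S zero ≡ K₀ + 2 * d
    d₀ with ∑-kernel k (suc m) (suc p) r (suc p′) r′ (s≤s p+r≤m)
    ... | d , eq = d , trans (S-letter zero) (trans (∑-cong absorb) eq)
      where
      absorb : ∀ (v : Vec A k) → shifted (suc m + k) p r p′ r′ (suc (#a v)) (#b v) ≡
                     shifted (suc m + k) (suc p) r (suc p′) r′ (#a v) (#b v)
      absorb v rewrite +-suc p (#a v) | +-suc p′ (#a v) = refl

    d₁ : ∃[ d ] S (suc zero) ≡ K₁ + 2 * d
    d₁ with ∑-kernel k (suc m) p (suc r) p′ (suc r′) (≤-trans (≤-reflexive (+-suc p r)) (s≤s p+r≤m))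
    ... | d , eq = d , trans (S-letter (suc zero)) (trans (∑-cong absorb) eq)
      where
      absorb : ∀ (v : Vec A k) → shifted (suc m + k) p r p′ r′ (#a v) (suc (#b v)) ≡
                     shifted (suc m + k) p (suc r) p′ (suc r′) (#a v) (#b v)
      absorb v rewrite +-suc r (#b v) | +-suc r′ (#b v) = refl

    -- Any other first letter lengthens the words without raising p + r, so the kernel term is 0 and
    -- only an even error remains.
    d₂ : ∀ i → ∃[ d ] S (suc (suc i)) ≡ 2 * d
    d₂ i with ∑-kernel k (suc m) p r p′ r′ (m≤n⇒m≤1+n p+r≤m)
    ... | d , eq = d , trans (S-letter (suc (suc i))) (trans eq
      (cong (_+ 2 * d) (kernel-other M m p r p′ r′ p+r≤m)))

    D₂ : ℕ
    D₂ = sum (λ i → proj₁ (d₂ i))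

    pascal : ∃[ d ] K₀ + K₁ ≡ kernel M m p r p′ r′ + 2 * d
    pascal = kernel-suc M m p r p′ r′

    d : ℕ
    d = proj₁ pascal + (proj₁ d₀ + (proj₁ d₁ + D₂))

  -- Nonzero only if both words lie in one set of words over a and b with fixed counts; it is then
  -- the coefficient with which the sign on that set enters the Hasse derivative at t = 1.
  κ : Vec A n → Vec A n → ℕ
  κ {n} x y = kernel M n (#a x) (#b x) (#a y) (#b y)

  κ-sym : (x y : Vec A n) → κ x y ≡ κ y x
  κ-sym {n} x y = kernel-sym M n (#a x) (#b x) (#a y) (#b y)

  κ-cong : (x x′ y y′ : Vec A n) → weight enum x ≗ weight enum x′ →
           weight enum y ≗ weight enum y′ → κ x y ≡ κ x′ y′
  κ-cong {n} x x′ y y′ x≗ y≗ = trans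
    (cong₂ (λ p r → kernel M n p r (#a y) (#b y)) (x≗ (letter zero)) (x≗ (letter (suc zero))))
    (cong₂ (kernel M n (#a x′) (#b x′)) (y≗ (letter zero)) (y≗ (letter (suc zero))))

  ∑-κ-++ : (u u′ : Vec A m) →
           ∃[ d ] ∑ (λ (v : Vec A n) → κ (u ++ v) (u′ ++ v)) ≡ κ u u′ + 2 * d
  ∑-κ-++ {m} {n} u u′
    with ∑-kernel n m (#a u) (#b u) (#a u′) (#b u′) (#a+#b≤length u)
  ... | d , eq = d , trans (∑-cong unfold) eq
    where
    unfold : ∀ (v : Vec A n) → κ (u ++ v) (u′ ++ v) ≡
             shifted (m + n) (#a u) (#b u) (#a u′) (#b u′) (#a v) (#b v)
    unfold v
      rewrite count-++ (letter zero ≟ᴬ_) u v | count-++ (letter (suc zero) ≟ᴬ_) u v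
            | count-++ (letter zero ≟ᴬ_) u′ v | count-++ (letter (suc zero) ≟ᴬ_) u′ v = refl

  -- Weighted inversion counts modulo 4

  -- Each inversion is counted as two ordered pairs, so the homomorphism takes
  -- values modulo 4.
  inversions : (Vec A n → Vec A n) → ℕ
  inversions g = ∑² (λ x y → ⟦ inverts g x y ⟧ * κ x y)

  inversions-cong : {g h : Vec A n → Vec A n} → g ≗ h → inversions g ≡ inversions h
  inversions-cong g≗h = ∑²-cong λ x y →
    cong₂ (λ x′ y′ → ⟦ before x y xor before x′ y′ ⟧ * κ x y) (g≗h x) (g≗h y)

  inversions-id : {g : Vec A n → Vec A n} → (∀ x → g x ≡ x) → inversions g ≡ 0
  inversions-id {n} g≗id = trans (inversions-cong {n} {h = id} g≗id)
    (∑-zero λ (x : Vec A n) → ∑-zero λ (y : Vec A n) → cong (λ b → ⟦ b ⟧ * κ x y) (xor-same (before x y)))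

  -- Serves the generators: their arity is at most M, where the kernel vanishes.
  inversions-short : n ≤ M → (g : Vec A n → Vec A n) → inversions g ≡ 0
  inversions-short n≤M g = ∑-zero λ x → ∑-zero λ y → trans
    (cong (⟦ inverts g x y ⟧ *_) (kernel-short M (#a x) (#b x) (#a y) (#b y) n≤M))
    (*-zeroʳ ⟦ inverts g x y ⟧)

  -- A pair is inverted by the composite if exactly one of the two maps inverts it on the way. Pairs
  -- inverted twice form the correction; they are symmetric and off the diagonal, so twice their
  -- total is a multiple of 4. As g is conservative, `κ` has the same value on a pair and on its
  -- image.
  inversions-∘ : (f g : Sym^ A n) → Conservative g →
    ∃[ c ] inversions (Inverse.to f ∘ Inverse.to g) + 4 * c ≡
           inversions (Inverse.to f) + inversions (Inverse.to g)
  inversions-∘ {n} f g g-cons = proj₁ even , (begin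
    inversions (f.to ∘ g.to) + 4 * proj₁ even
      ≡⟨ cong (inversions (f.to ∘ g.to) +_) (trans (*-assoc 2 2 (proj₁ even)) (cong (2 *_) (sym (proj₂ even)))) ⟩
    inversions (f.to ∘ g.to) + 2 * ∑² both
      ≡⟨ cong (inversions (f.to ∘ g.to) +_) (∑²-*ˡ 2 both) ⟨
    inversions (f.to ∘ g.to) + ∑² (λ x y → 2 * both x y)
      ≡⟨ ∑²-+ (λ x y → ⟦ inverts (f.to ∘ g.to) x y ⟧ * κ x y) (λ x y → 2 * both x y) ⟨
    ∑² (λ x y → ⟦ inverts (f.to ∘ g.to) x y ⟧ * κ x y + 2 * both x y)
      ≡⟨ ∑²-cong pointwise ⟩
    ∑² (λ x y → F (g.to x) (g.to y) + G x y)
      ≡⟨ ∑²-+ (λ x y → F (g.to x) (g.to y)) G ⟩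
    ∑² (λ x y → F (g.to x) (g.to y)) + ∑² G
      ≡⟨ cong (_+ ∑² G) (∑²-reindex g F) ⟩
    inversions f.to + inversions g.to ∎)
    where
    module f = Inverse f
    module g = Inverse g

    F G both : Vec A n → Vec A n → ℕ
    F x y = ⟦ inverts f.to x y ⟧ * κ x y
    G x y = ⟦ inverts g.to x y ⟧ * κ x y
    both x y = ⟦ inverts g.to x y ∧ inverts f.to (g.to x) (g.to y) ⟧ * κ x y

    even : ∃[ c ] ∑² both ≡ 2 * c
    even = ∑²-even both
      (λ x y → cong₂ _*_
        (cong ⟦_⟧ (cong₂ _∧_ (inverts-sym g x y) (inverts-sym f (g.to x) (g.to y))))
        (κ-sym x y))
      (λ x → cong (λ b → ⟦ b ∧ inverts f.to (g.to x) (g.to x) ⟧ * κ x x) (inverts-diag g.to x))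

    pointwise : ∀ x y → ⟦ inverts (f.to ∘ g.to) x y ⟧ * κ x y + 2 * both x y ≡
                        F (g.to x) (g.to y) + G x y
    pointwise x y = begin
      ⟦ inverts (f.to ∘ g.to) x y ⟧ * κ x y + 2 * (⟦ i ∧ j ⟧ * κ x y)
        ≡⟨ cong (λ b → ⟦ b ⟧ * κ x y + 2 * (⟦ i ∧ j ⟧ * κ x y))
             (xor-telescope (before x y) (before (g.to x) (g.to y)) _) ⟩
      ⟦ i xor j ⟧ * κ x y + 2 * (⟦ i ∧ j ⟧ * κ x y)
        ≡⟨ solve 3 (λ s t k → s :* k :+ con 2 :* (t :* k) := (s :+ con 2 :* t) :* k)
             refl ⟦ i xor j ⟧ ⟦ i ∧ j ⟧ (κ x y) ⟩
      (⟦ i xor j ⟧ + 2 * ⟦ i ∧ j ⟧) * κ x y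
        ≡⟨ cong (_* κ x y) (⟦xor⟧ i j) ⟩
      (⟦ i ⟧ + ⟦ j ⟧) * κ x y
        ≡⟨ solve 3 (λ s t k → (s :+ t) :* k := t :* k :+ s :* k) refl ⟦ i ⟧ ⟦ j ⟧ (κ x y) ⟩
      ⟦ j ⟧ * κ x y + ⟦ i ⟧ * κ x y
        ≡⟨ cong (λ k → ⟦ j ⟧ * k + G x y) (κ-cong (g.to x) x (g.to y) y (g-cons x) (g-cons y)) ⟨
      F (g.to x) (g.to y) + G x y ∎
      where
      i j : Bool
      i = inverts g.to x y
      j = inverts f.to (g.to x) (g.to y)

  -- Each pair inverted by f recurs once for every common suffix, and the kernels of these copies
  -- add up to `κ u u′` modulo 2. The error terms are symmetric and vanish on the diagonal, which
  -- improves the congruence to one modulo 4.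
  inversions-⊕ : (f : Sym^ A m) → ∀ k →
    ∃[ c ] inversions (Inverse.to (f ⊕ ↔-id (Vec A k))) ≡ inversions (Inverse.to f) + 4 * c
  inversions-⊕ {m} f k = proj₁ even , (begin
    ∑ (λ x → ∑ (λ y → ext x y))
      ≡⟨ ∑-++ m {k} (λ x → ∑ (ext x)) ⟩
    ∑ (λ (v : Vec A k) → ∑ (λ u → ∑ (ext (u ++ v))))
      ≡⟨ ∑-cong (λ v → ∑-cong (λ u → fibre u v)) ⟩
    ∑ (λ (v : Vec A k) → ∑ (λ u → ∑ (λ u′ → e u u′ * κ (u ++ v) (u′ ++ v))))
      ≡⟨ ∑-swap (λ (v : Vec A k) u → ∑ (λ u′ → e u u′ * κ (u ++ v) (u′ ++ v))) ⟩
    ∑ (λ u → ∑ (λ (v : Vec A k) → ∑ (λ u′ → e u u′ * κ (u ++ v) (u′ ++ v))))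
      ≡⟨ ∑-cong (λ u → ∑-swap (λ (v : Vec A k) u′ → e u u′ * κ (u ++ v) (u′ ++ v))) ⟩
    ∑² (λ u u′ → ∑ (λ (v : Vec A k) → e u u′ * κ (u ++ v) (u′ ++ v)))
      ≡⟨ ∑²-cong (λ u u′ → trans
           (∑-*ˡ (e u u′) (λ (v : Vec A k) → κ (u ++ v) (u′ ++ v)))
           (cong (e u u′ *_) (proj₂ (∑-κ-++ {n = k} u u′)))) ⟩
    ∑² (λ u u′ → e u u′ * (κ u u′ + 2 * d u u′))
      ≡⟨ ∑²-cong (λ u u′ → solve 3 (λ s t z → s :* (t :+ con 2 :* z) := s :* t :+ con 2 :* (s :* z))
           refl (e u u′) (κ u u′) (d u u′)) ⟩
    ∑² (λ u u′ → e u u′ * κ u u′ + 2 * (e u u′ * d u u′))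
      ≡⟨ ∑²-+ (λ u u′ → e u u′ * κ u u′) (λ u u′ → 2 * (e u u′ * d u u′)) ⟩
    inversions f.to + ∑² (λ u u′ → 2 * (e u u′ * d u u′))
      ≡⟨ cong (inversions f.to +_) (trans (∑²-*ˡ 2 (λ u u′ → e u u′ * d u u′)) (cong (2 *_) (proj₂ even))) ⟩
    inversions f.to + 2 * (2 * proj₁ even)
      ≡⟨ cong (inversions f.to +_) (*-assoc 2 2 (proj₁ even)) ⟨
    inversions f.to + 4 * proj₁ even ∎)
    where
    module f = Inverse f

    e d : Vec A m → Vec A m → ℕ
    e u u′ = ⟦ inverts f.to u u′ ⟧
    d u u′ = proj₁ (∑-κ-++ {n = k} u u′)

    ext : Vec A (m + k) → Vec A (m + k) → ℕ
    ext x y = ⟦ inverts (Inverse.to (f ⊕ ↔-id (Vec A k))) x y ⟧ * κ x y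

    -- The witness is determined by its equation, in which all other terms are symmetric.
    d-sym : ∀ u u′ → d u u′ ≡ d u′ u
    d-sym u u′ = *-cancelˡ-≡ (d u u′) (d u′ u) 2 (+-cancelˡ-≡ (κ u u′) (2 * d u u′) (2 * d u′ u) (begin
      κ u u′ + 2 * d u u′                                ≡⟨ proj₂ (∑-κ-++ {n = k} u u′) ⟨
      ∑ (λ (v : Vec A k) → κ (u ++ v) (u′ ++ v))         ≡⟨ ∑-cong (λ (v : Vec A k) → κ-sym (u ++ v) (u′ ++ v)) ⟩
      ∑ (λ (v : Vec A k) → κ (u′ ++ v) (u ++ v))         ≡⟨ proj₂ (∑-κ-++ {n = k} u′ u) ⟩
      κ u′ u + 2 * d u′ u                                ≡⟨ cong (_+ 2 * d u′ u) (κ-sym u′ u) ⟩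
      κ u u′ + 2 * d u′ u                                ∎))

    even : ∃[ c ] ∑² (λ u u′ → e u u′ * d u u′) ≡ 2 * c
    even = ∑²-even (λ u u′ → e u u′ * d u u′)
      (λ u u′ → cong₂ _*_ (cong ⟦_⟧ (inverts-sym f u u′)) (d-sym u u′))
      (λ u → cong (λ b → ⟦ b ⟧ * d u u) (inverts-diag f.to u))

    -- Suffixes v′ other than v contribute nothing, by `inverts-⊕`.
    fibre : ∀ u v → ∑ (ext (u ++ v)) ≡ ∑ (λ u′ → e u u′ * κ (u ++ v) (u′ ++ v))
    fibre u v = begin
      ∑ (ext (u ++ v))
        ≡⟨ ∑-++ m {k} (ext (u ++ v)) ⟩
      ∑ (λ (v′ : Vec A k) → ∑ (λ u′ → ext (u ++ v) (u′ ++ v′)))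
        ≡⟨ ∑-cong (λ v′ → trans
             (∑-cong (λ u′ → trans
               (cong (_* κ (u ++ v) (u′ ++ v′)) (inverts-⊕ f u u′ v v′))
               (*-assoc ⟦ does (v ≟ʷ v′) ⟧ (e u u′) (κ (u ++ v) (u′ ++ v′)))))
             (∑-*ˡ ⟦ does (v ≟ʷ v′) ⟧ (λ u′ → e u u′ * κ (u ++ v) (u′ ++ v′)))) ⟩
      ∑ (λ (v′ : Vec A k) → ⟦ does (v ≟ʷ v′) ⟧ * ∑ (λ u′ → e u u′ * κ (u ++ v) (u′ ++ v′)))
        ≡⟨ ∑-δ v (λ v′ → ∑ (λ u′ → e u u′ * κ (u ++ v) (u′ ++ v′))) ⟩
      ∑ (λ u′ → e u u′ * κ (u ++ v) (u′ ++ v)) ∎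

  -- The inversion count of a transposition

  -- The pair {u, w} is inverted and has weight 1. The other inverted pairs contain exactly one of u
  -- and w and come in twos of equal weight, as `κ` depends only on letter counts. Ordered pairs
  -- double the total.
  inversions-transposition : (u w : Vec A n) → u ≢ w → weight enum u ≗ weight enum w → κ u w ≡ 1 →
    ∃[ h ] inversions (transposeʷ u w) ≡ 2 * (1 + 2 * h)
  inversions-transposition {n} u w u≢w u≗w κ-uw = ∑ h , (begin
    inversions (transposeʷ u w)
      ≡⟨ ∑²-cong pointwise ⟩
    ∑² (λ x y → G x y + G y x)
      ≡⟨ ∑²-symmetrized G ⟩
    2 * ∑² G
      ≡⟨ cong (2 *_) (trans (∑-cong row) (∑-+ (λ x → ⟦ does (u ≟ʷ x) ⟧ * 1) R)) ⟩
    2 * (∑ (λ x → ⟦ does (u ≟ʷ x) ⟧ * 1) + ∑ R)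
      ≡⟨ cong (2 *_) (cong₂ _+_ (∑-δ u (λ _ → 1)) (trans
           (∑-+ (λ x → ⟦ does (u ≟ʷ x) ⟧ * ∑ h) (λ x → ⟦ does (w ≟ʷ x) ⟧ * ∑ h))
           (cong₂ _+_ (∑-δ u (λ _ → ∑ h)) (∑-δ w (λ _ → ∑ h))))) ⟩
    2 * (1 + (∑ h + ∑ h))
      ≡⟨ cong (λ s → 2 * (1 + (∑ h + s))) (+-identityʳ (∑ h)) ⟨
    2 * (1 + 2 * ∑ h) ∎)
    where
    -- For z outside {u, w}, the pairs {z, u} and {z, w} are inverted simultaneously.
    h : Vec A n → ℕ
    h z = if does (u ≟ʷ z) then 0 else if does (w ≟ʷ z) then 0
          else ⟦ before u z xor before w z ⟧ * κ u z

    -- One ordering of each inverted pair: u before w with weight 1, and u or w followed by a word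
    -- outside {u, w}. The transpose of `G` supplies the other ordering.
    G : Vec A n → Vec A n → ℕ
    G x y = ⟦ does (u ≟ʷ x) ⟧ * (⟦ does (w ≟ʷ y) ⟧ * 1)
          + (⟦ does (u ≟ʷ x) ⟧ * h y + ⟦ does (w ≟ʷ x) ⟧ * h y)

    R : Vec A n → ℕ
    R x = ⟦ does (u ≟ʷ x) ⟧ * ∑ h + ⟦ does (w ≟ʷ x) ⟧ * ∑ h

    row : ∀ x → ∑ (G x) ≡ ⟦ does (u ≟ʷ x) ⟧ * 1 + R x
    row x = trans
      (∑-+ (λ y → ⟦ does (u ≟ʷ x) ⟧ * (⟦ does (w ≟ʷ y) ⟧ * 1))
           (λ y → ⟦ does (u ≟ʷ x) ⟧ * h y + ⟦ does (w ≟ʷ x) ⟧ * h y))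
      (cong₂ _+_
        (trans (∑-*ˡ ⟦ does (u ≟ʷ x) ⟧ (λ y → ⟦ does (w ≟ʷ y) ⟧ * 1))
               (cong (⟦ does (u ≟ʷ x) ⟧ *_) (∑-δ w (λ _ → 1))))
        (trans (∑-+ (λ y → ⟦ does (u ≟ʷ x) ⟧ * h y) (λ y → ⟦ does (w ≟ʷ x) ⟧ * h y))
               (cong₂ _+_ (∑-*ˡ ⟦ does (u ≟ʷ x) ⟧ h) (∑-*ˡ ⟦ does (w ≟ʷ x) ⟧ h))))

    κ-w : ∀ z → κ w z ≡ κ u z
    κ-w z = κ-cong w u z z (λ c → sym (u≗w c)) (λ _ → refl)

    xor-flip : ∀ {z} → u ≢ z → w ≢ z →
               ⟦ before z u xor before z w ⟧ * κ z u ≡ ⟦ before u z xor before w z ⟧ * κ u z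
    xor-flip {z} u≢z w≢z = cong₂ (λ b k → ⟦ b ⟧ * k)
      (trans (cong₂ _xor_ (before-flip u≢z) (before-flip w≢z)) (not-xor-not (before u z) (before w z)))
      (κ-sym z u)

    xor-swap : ∀ z → ⟦ before w z xor before u z ⟧ * κ w z ≡ ⟦ before u z xor before w z ⟧ * κ u z
    xor-swap z = cong₂ (λ b k → ⟦ b ⟧ * k) (xor-comm (before w z) (before u z)) (κ-w z)

    padʳ : ∀ {s t} → s ≡ t → s + 0 ≡ t
    padʳ {s} s≡t = trans (+-identityʳ s) s≡t

    pointwise : ∀ x y → ⟦ inverts (transposeʷ u w) x y ⟧ * κ x y ≡ G x y + G y x
    pointwise x y with u ≟ʷ x | w ≟ʷ x | u ≟ʷ y | w ≟ʷ y
    ... | yes refl | yes w≡u | _        | _        = contradiction (sym w≡u) u≢w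
    ... | _        | _       | yes refl | yes w≡u  = contradiction (sym w≡u) u≢w
    ... | yes refl | no _    | yes refl | no _
      rewrite before-irrefl u | before-irrefl w = refl
    ... | yes refl | no _    | no _     | yes refl
      rewrite before-flip u≢w | κ-uw with before u w
    ...   | true  = refl
    ...   | false = refl
    pointwise x y | no _ | yes refl | yes refl | no _
      rewrite before-flip u≢w | trans (κ-sym w u) κ-uw with before u w
    ...   | true  = refl
    ...   | false = refl
    pointwise x y | no _ | yes refl | no _ | yes refl
      rewrite before-irrefl u | before-irrefl w = refl
    -- Exactly one of x and y is u or w here: a single summand survives, equal to `h` at the other
    -- word.
    pointwise x y | yes refl | no _ | no _ | no _ = sym (padʳ (padʳ (padʳ refl)))
    pointwise x y | no _ | yes refl | no _ | no _ = trans (xor-swap y) (sym (padʳ (padʳ refl)))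
    pointwise x y | no u≢x | no w≢x | yes refl | no _ = trans (xor-flip u≢x w≢x) (sym (padʳ (padʳ refl)))
    pointwise x y | no u≢x | no w≢x | no _ | yes refl = trans
      (cong₂ (λ b k → ⟦ b ⟧ * k) (xor-comm (before x w) (before x u)) (trans (κ-sym x w) (trans (κ-w x) (κ-sym u x))))
      (trans (xor-flip u≢x w≢x) (sym (padʳ refl)))
    pointwise x y | no _ | no _ | no _ | no _
      rewrite xor-same (before x y) = refl

  -- Divisibility by 4 as an invariant of generated gates

  4∣inversions-∘ : (f g : Sym^ A n) → Conservative g →
    4 ∣ inversions (Inverse.to f) → 4 ∣ inversions (Inverse.to g) →
    4 ∣ inversions (Inverse.to f ∘ Inverse.to g)
  4∣inversions-∘ f g g-cons 4∣f 4∣g = let c , eq = inversions-∘ f g g-cons in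
    ∣m+n∣m⇒∣n
      (subst (4 ∣_) (trans (sym eq) (+-comm (inversions (Inverse.to f ∘ Inverse.to g)) (4 * c)))
        (∣m∣n⇒∣m+n 4∣f 4∣g))
      (m∣m*n c)

  -- Modulo 4 the counts of the wire permutation and its inverse cancel, because their composite is
  -- the identity; neither count has to be computed.
  4∣inversions-rewiring : (α : Permutation′ n) (f : Sym^ A n) → Conservative (rewiring α f) →
    4 ∣ inversions (Inverse.to f) → 4 ∣ inversions (Inverse.to (rewiring α f))
  4∣inversions-rewiring {n} α f cons 4∣f =
    ∣m+n∣m⇒∣n (subst (4 ∣_) (sym total) (∣m∣n⇒∣m+n 4∣f (m∣m*n c₃))) (m∣m*n (c₁ + c₂))
    where
    whole rest Π Π⁻¹ inner : ℕ
    whole = inversions (Inverse.to (rewiring α f))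
    rest  = inversions (Inverse.to f ∘ wire (flip α))
    Π     = inversions (wire {A = A} α)
    Π⁻¹   = inversions (wire {A = A} (flip α))
    inner = inversions (Inverse.to f)

    eq-whole : ∃[ c ] whole + 4 * c ≡ Π + rest
    -- The inner factor is conservative because the whole rewiring is and the outer wire permutation
    -- preserves weights.
    eq-whole = inversions-∘ π[ α ] (f ↔-∘ ↔-sym π[ α ]) λ x c →
      trans (sym (wire-conservative α (Inverse.to f (wire (flip α) x)) c)) (cons x c)

    eq-rest : ∃[ c ] rest + 4 * c ≡ inner + Π⁻¹
    eq-rest = inversions-∘ f (↔-sym π[ α ]) (wire-conservative (flip α))

    eq-id : ∃[ c ] inversions (wire {A = A} α ∘ wire (flip α)) + 4 * c ≡ Π + Π⁻¹
    eq-id = inversions-∘ π[ α ] (↔-sym π[ α ]) (wire-conservative (flip α))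

    c₁ c₂ c₃ : ℕ
    c₁ = proj₁ eq-whole
    c₂ = proj₁ eq-rest
    c₃ = proj₁ eq-id

    total : 4 * (c₁ + c₂) + whole ≡ inner + 4 * c₃
    total = begin
      4 * (c₁ + c₂) + whole
        ≡⟨ solve 3 (λ i x y → con 4 :* (x :+ y) :+ i := (i :+ con 4 :* x) :+ con 4 :* y) refl whole c₁ c₂ ⟩
      (whole + 4 * c₁) + 4 * c₂
        ≡⟨ cong (_+ 4 * c₂) (proj₂ eq-whole) ⟩
      (Π + rest) + 4 * c₂
        ≡⟨ +-assoc Π rest (4 * c₂) ⟩
      Π + (rest + 4 * c₂)
        ≡⟨ cong (Π +_) (proj₂ eq-rest) ⟩
      Π + (inner + Π⁻¹)
        ≡⟨ solve 3 (λ x y z → x :+ (y :+ z) := y :+ (x :+ z)) refl Π inner Π⁻¹ ⟩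
      inner + (Π + Π⁻¹)
        ≡⟨ cong (inner +_) (proj₂ eq-id) ⟨
      inner + (inversions (wire {A = A} α ∘ wire (flip α)) + 4 * c₃)
        ≡⟨ cong (λ s → inner + (s + 4 * c₃)) (inversions-id (Inverse.strictlyInverseˡ π[ α ])) ⟩
      inner + 4 * c₃ ∎

  -- Allows one computation for f to exclude all the gates f ⊕ id_k.
  4∣inversions-⊕⇒4∣inversions : (f : Sym^ A m) → ∀ k →
    4 ∣ inversions (Inverse.to (f ⊕ ↔-id (Vec A k))) → 4 ∣ inversions (Inverse.to f)
  4∣inversions-⊕⇒4∣inversions f k 4∣f⊕id = let c , eq = inversions-⊕ f k in ∣m+n∣m⇒∣n
    (subst (4 ∣_) (trans eq (+-comm (inversions (Inverse.to f)) (4 * c))) 4∣f⊕id) (m∣m*n c)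

  -- Induction on the generation of the gate. Conservativity of the whole closure supplies the
  -- hypotheses for composition and rewiring.
  4∣inversions-generated : ∀ {ℓ} (P : Pred (Gate A) ℓ) → (∀ {g} → g ∈ P → suc (proj₁ g) ≤ M) →
    ⌈ P ⌉ ⊆ Cons enum → ∀ {n} {f : Sym^ A (suc n)} → (n , f) ∈ ⌈ P ⌉ → 4 ∣ inversions (Inverse.to f)
  4∣inversions-generated P short cons = go
    where
    go : ∀ {n} {f : Sym^ A (suc n)} → (n , f) ∈ ⌈ P ⌉ → 4 ∣ inversions (Inverse.to f)
    go id₁ = subst (4 ∣_) (sym (inversions-id {g = Inverse.to (↔-id (Vec A 1))} λ _ → refl)) (4 ∣0)
    go {f = f} (generator f∈P) =
      subst (4 ∣_) (sym (inversions-short (short f∈P) (Inverse.to f))) (4 ∣0)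
    go (compose {f = f} {g = g} f∈ g∈) = 4∣inversions-∘ f g (cons g∈) (go f∈) (go g∈)
    go (extension {f = f} f∈ k α) = let c , eq = inversions-⊕ f k in
      4∣inversions-rewiring α (f ⊕ ↔-id (Vec A k)) (cons (extension f∈ k α))
      (subst (4 ∣_) (sym eq) (∣m∣n⇒∣m+n (go f∈) (m∣m*n c)))
    go (resp f≗g f∈) = subst (4 ∣_) (inversions-cong f≗g) (go f∈)

  4∤inversions-transposition : (u w : Vec A n) → u ≢ w → weight enum u ≗ weight enum w → κ u w ≡ 1 →
    ¬ 4 ∣ inversions (transposeʷ u w)
  4∤inversions-transposition u w u≢w u≗w κ-uw 4∣
    = contradiction (∣1⇒≡1 2∣1) λ ()
    where
    2∣1 : 2 ∣ 1
    2∣1 = let h , eq = inversions-transposition u w u≢w u≗w κ-uw in ∣m+n∣m⇒∣n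
      (subst (2 ∣_) (+-comm 1 (2 * h)) (*-cancelˡ-∣ 2 (subst (4 ∣_) eq 4∣)))
      (m∣m*n h)

-- A transposition that escapes a finite set of generators

arities-bounded : ∀ {a} {A : Set a} (P : List (Gate A)) → ∃[ N ] (∀ {g} → g List.∈ P → proj₁ g ≤ N)
arities-bounded []      = 0 , λ ()
arities-bounded (p ∷ P) with arities-bounded P
... | N , bound = proj₁ p ⊔ N , λ where
  (here refl) → m≤m⊔n (proj₁ p) N
  (there g∈P) → ≤-trans (bound g∈P) (m≤n⊔m (proj₁ p) N)

-- The gate f has a clause of its own beside k = 0, since `f ⊕id 0` has an arity of the form n + 0,
-- not definitionally that of f.
transposition-not-generated : ∀ {a} {A : Set a} {q : ℕ} (enum : A ↔ Fin (suc (suc q))) (P : List (Gate A)) →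
  ⌈ (λ g → g List.∈ P) ⌉ ⊆ Cons enum →
  ∃[ f ] (f ∈ Cons enum × f ∉ ⌈ (λ g → g List.∈ P) ⌉ × (∀ k → (f ⊕id k) ∉ ⌈ (λ g → g List.∈ P) ⌉))
transposition-not-generated {A = A} enum P cons =
  (suc N , τ) , transposition-conservative u w u≗w ,
  (λ τ∈ → odd (even τ∈)) ,
  (λ k τ⊕id∈ → odd (4∣inversions-⊕⇒4∣inversions τ k (even τ⊕id∈)))
  where
  N : ℕ
  N = proj₁ (arities-bounded P)

  -- The first component of a gate is its arity minus one, so a bound `N` on it gives M = N + 1.
  open Sign enum (suc N)

  a b : A
  a = Inverse.from enum zero
  b = Inverse.from enum (suc zero)

  t : Vec A N
  t = replicate N a

  u w : Vec A (suc (suc N))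
  -- Length N + 2 = M + 1 is the least at which `κ` can be nonzero; the padding by a keeps the words
  -- free of third letters.
  u = a ∷ b ∷ t
  w = b ∷ a ∷ t

  τ : Sym^ A (suc (suc N))
  τ = transposition u w

  a≢b : a ≢ b
  a≢b a≡b = contradiction (Injection.injective (↔⇒↣ (↔-sym enum)) a≡b) λ ()

  u≗w : weight enum u ≗ weight enum w
  u≗w c with does (c ≟ᴬ a) | does (c ≟ᴬ b)
  ... | true  | true  = refl
  ... | true  | false = refl
  ... | false | true  = refl
  ... | false | false = refl

  #t : ∀ n → #a (replicate n a) + #b (replicate n a) ≡ n
  #t zero    = refl
  #t (suc n)
    rewrite weight-letter-∷ zero zero (replicate n a) | weight-letter-∷ zero (suc zero) (replicate n a) =
    cong suc (#t n)

  #u : #a u + #b u ≡ suc (suc N)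
  #u rewrite weight-letter-∷ zero zero (b ∷ t) | weight-letter-∷ (suc zero) zero t
           | weight-letter-∷ zero (suc zero) (b ∷ t) | weight-letter-∷ (suc zero) (suc zero) t =
    cong suc (trans (+-suc (#a t) (#b t)) (cong suc (#t N)))

  κ-uw : κ u w ≡ 1
  κ-uw = trans (κ-cong u u w u (λ _ → refl) (λ c → sym (u≗w c))) (kernel-diag (suc N) (#a u) (#b u) #u)

  even : ∀ {n} {f : Sym^ A (suc n)} → (n , f) ∈ ⌈ (λ g → g List.∈ P) ⌉ → 4 ∣ inversions (Inverse.to f)
  even = 4∣inversions-generated (λ g → g List.∈ P) (λ g∈P → s≤s (proj₂ (arities-bounded P) g∈P)) cons

  odd : ¬ 4 ∣ inversions (Inverse.to τ)
  odd = 4∤inversions-transposition u w (a≢b ∘ ∷-injectiveˡ) u≗w κ-uw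

theorem27 : ∀ {a ℓ : Level} {A : Set a} {q : ℕ} (enum : A ↔ Fin q) → 1 < q →
    (¬ FinitelyGenerated (Cons enum))
    × ((C : Pred (Gate A) ℓ) → IsRevital C → FinitelyGenerated C → C ⊆ Cons enum →
    ∃[ f ] (f ∈ Cons enum × (∀ (k : ℕ) → (f ⊕id k) ∉ C))
    )
theorem27 {q = suc zero}    enum (s≤s ())
theorem27 {q = suc (suc _)} enum _ = not-fg , escaping
  where
  not-fg : ¬ FinitelyGenerated (Cons enum)
  not-fg (P , Cons⊆ , ⊆Cons) =
    let f , f∈Cons , f∉ , _ = transposition-not-generated enum P ⊆Cons in f∉ (Cons⊆ f∈Cons)

  escaping : (C : Pred (Gate _) _) → IsRevital C → FinitelyGenerated C → C ⊆ Cons enum →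
             ∃[ f ] (f ∈ Cons enum × (∀ (k : ℕ) → (f ⊕id k) ∉ C))
  escaping C _ (P , C⊆ , ⊆C) C⊆Cons =
    let f , f∈Cons , _ , f⊕id∉ = transposition-not-generated enum P (λ g∈ → C⊆Cons (⊆C g∈))
    in f , f∈Cons , λ k f⊕id∈C → f⊕id∉ k (C⊆ f⊕id∈C)
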